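{- Let $G$ be a nontrivial connected graph of order $n$. Then $0\leq spvc(G)\leq n-2$. Equality on the right-hand side (that is, $spvc(G)=n-2$) is attained if and only if $G\in\{P_3,P_4\}$, where $P_m$ denotes the path on $m$ vertices.
   Context: All graphs are simple, finite and undirected; the order of a graph is its number of vertices, and a graph is nontrivial if it has at least two vertices. Vertex-colorings are arbitrary (adjacent vertices may receive the same color). A path in a vertex-colored graph is a vertex-proper path if any two internal adjacent vertices of the path differ in color (the end-vertices are not internal). A $u$-$v$ geodesic is a $u$-$v$ path of length $d(u,v)$, where $d(u,v)$ is the distance between $u$ and $v$. A vertex-colored graph is strong proper vertex-connected if for any two vertices $u,v$ of the graph there exists a vertex-proper $u$-$v$ geodesic. For a connected graph $G$, the strong proper vertex-connection number $spvc(G)$ is the smallest number of colors required to make $G$ strong proper vertex-connected. The value $0$ is allowed: $spvc(G)=0$ if and only if $G$ is a complete graph, and $spvc(G)=1$ if and only if $G$ has diameter $2$.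
   Formalization: The characterization of equality is stated only for order n ≥ 3, since at n = 2 the graph K_2 = P_2 has spvc = 0 = n − 2 but is neither P_3 nor P_4; the bounds 0 ≤ spvc(G) ≤ n − 2 are stated for all n ≥ 2. -}

module Defs where

open import Data.Fin.Base using (Fin; toℕ)
open import Data.List.Base as List using (List; []; _∷_; _∷ʳ_)
open import Data.List.Relation.Unary.Linked using (Linked)
open import Data.List.Relation.Unary.Unique.Propositional using (Unique)
open import Data.Nat.Base using (ℕ; zero; suc; _≤_)
import Data.Nat.Properties as ℕ
open import Data.Product.Base using (Σ; ∃; _×_; _,_)
open import Data.Sum.Base using (_⊎_; inj₁; inj₂)
import Data.Sum.Base as Sum
open import Function.Bundles using (_↔_; _⇔_; Inverse)
open import Level using (0ℓ)
open import Relation.Binary.Construct.Closure.ReflexiveTransitive using (Star; ε; _◅_)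
open import Relation.Binary.Core using (Rel)
open import Relation.Binary.Definitions using (Symmetric; Irreflexive; Decidable)
open import Relation.Binary.PropositionalEquality.Core using (_≡_; _≢_; refl)
open import Relation.Nullary.Decidable using (_⊎-dec_)

-- Adjacency is decidable, as it is classically for every finite graph.
record Graph (n : ℕ) : Set₁ where
  field
    _~_      : Rel (Fin n) 0ℓ
    ~-sym    : Symmetric _~_
    ~-irrefl : Irreflexive _≡_ _~_
    _~?_     : Decidable _~_

record _≅_ {m n} (G : Graph m) (H : Graph n) : Set where
  private
    module G = Graph G
    module H = Graph H
  field
    bijection : Fin m ↔ Fin n
    adjacency : ∀ u v → (u G.~ v) ⇔ (Inverse.to bijection u H.~ Inverse.to bijection v)

P : (m : ℕ) → Graph m
P m = record
  { _~_      = λ i j → suc (toℕ i) ≡ toℕ j ⊎ suc (toℕ j) ≡ toℕ i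
  ; ~-sym    = Sum.swap
  ; ~-irrefl = λ { refl (inj₁ e) → ℕ.1+n≢n e ; refl (inj₂ e) → ℕ.1+n≢n e }
  ; _~?_     = λ i j → (suc (toℕ i) ℕ.≟ toℕ j) ⊎-dec (suc (toℕ j) ℕ.≟ toℕ i)
  }

module _ {n : ℕ} (G : Graph n) where
  open Graph G

  Walk : Rel (Fin n) 0ℓ
  Walk = Star _~_

  -- All vertices of the walk, in order, except the last one.
  initVertices : ∀ {u v} → Walk u v → List (Fin n)
  initVertices ε                 = []
  initVertices (_◅_ {i = u} _ p) = u ∷ initVertices p

  vertices : ∀ {u v} → Walk u v → List (Fin n)
  vertices {v = v} p = initVertices p ∷ʳ v

  internalVertices : ∀ {u v} → Walk u v → List (Fin n)
  internalVertices ε       = []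
  internalVertices (_ ◅ p) = initVertices p

  Path : Rel (Fin n) 0ℓ
  Path u v = Σ (Walk u v) λ p → Unique (vertices p)

  -- The number of edges.
  length : ∀ {u v} → Path u v → ℕ
  length (p , _) = List.length (initVertices p)

  Connected : Set
  Connected = ∀ u v → Path u v

  Complete : Set
  Complete = ∀ u v → u ≢ v → u ~ v

  IsDistance : Fin n → Fin n → ℕ → Set
  IsDistance u v d = (∃ λ (p : Path u v) → length p ≡ d) × (∀ (q : Path u v) → d ≤ length q)

  IsGeodesic : ∀ {u v} → Path u v → Set
  IsGeodesic {u} {v} p = IsDistance u v (length p)

  Colouring : ℕ → Set
  Colouring k = Fin n → Fin k

  VertexProper : ∀ {k} → Colouring k → ∀ {u v} → Path u v → Set
  VertexProper c (p , _) = Linked (λ x y → c x ≢ c y) (internalVertices p)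

  StrongProperVertexConnected : ∀ {k} → Colouring k → Set
  StrongProperVertexConnected c =
    ∀ u v → ∃ λ (p : Path u v) → IsGeodesic p × VertexProper c p

  -- A nonempty graph has no colouring Fin n → Fin 0, so the value 0 has to be
  -- given a meaning separately: by convention no colours are needed exactly
  -- when G is complete, i.e. when no geodesic has an internal vertex.
  SufficientColours : ℕ → Set
  SufficientColours zero    = Complete
  SufficientColours (suc k) = ∃ λ (c : Colouring (suc k)) → StrongProperVertexConnected c

  -- k = spvc(G)
  IsSpvc : ℕ → Set
  IsSpvc k = SufficientColours k × (∀ j → SufficientColours j → k ≤ j)

{-# OPTIONS --safe #-}
module Submission where

-- A proper colouring is always strong proper, and a colouring is needed only up to
-- the choice of a geodesic; so it suffices to find n − 3 colours when n ≥ 5 and the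
-- diameter is at least 3, the smaller cases being complete graphs (0 colours),
-- diameter 2 (1 colour) and P₄ (2 colours).
--
-- Diameter ≥ 4: on a path y₄ y₃ y₂ y₁ u descending to u, the independent classes
-- {u, y₂, y₄} and {y₁, y₃} save three colours.
--
-- Diameter 3, some u with two vertices c ≠ c′ at distance 3: let c b a u be a geodesic.
-- If c, c′ can be chosen nonadjacent, use {u, b}, {a, c, c′}; if u has a second neighbour a′,
-- use {u, b}, {a, c}, {a′, c′}. Otherwise a is the only neighbour of u and the vertices at
-- distance 3 from u form a clique; {u, b}, {a, c, c′} still works, because a geodesic of
-- length 3 whose middle edge is cc′ can be rerouted through a.
--
-- Diameter 3, the pairs at distance 3 forming a matching: three such pairs can be merged
-- into three classes; for at most two pairs, two colours make the two middle edges bichromatic.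

open import Defs
open import Data.Fin.Base as Fin using (Fin; zero; suc; toℕ; fromℕ; fromℕ<; inject≤; punchOut; opposite; funToFin; finToFun)
open import Data.Fin.Permutation using (↔⇒≡)
open import Data.Fin.Properties as Fin using (_≟_; any?; all?)
open import Data.List.Base as List using (List; []; _∷_; drop)
open import Data.List.Membership.Propositional using (_∈_; _∉_)
open import Data.List.Membership.DecPropositional using (_∈?_)
open import Data.List.Relation.Unary.All as All using (All; []; _∷_)
open import Data.List.Relation.Unary.All.Properties using (¬Any⇒All¬)
open import Data.List.Relation.Unary.AllPairs using (AllPairs; []; _∷_)
open import Data.List.Relation.Unary.Any using (here; there)
open import Data.List.Relation.Unary.Linked as Linked using (Linked; []; [-]; _∷_)
open import Data.List.Relation.Unary.Unique.Propositional using (Unique)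
open import Data.Nat.Base using (ℕ; zero; suc; _+_; _∸_; _≤_; _<_; z≤n; s≤s; s≤s⁻¹)
open import Data.Nat.Properties as ℕ using (≤-refl; ≤-trans; ≤-antisym; ≤-reflexive; _≤?_)
open import Data.Product.Base using (∃; ∃-syntax; ∃₂; _×_; _,_; proj₁; proj₂)
open import Data.Sum.Base using (_⊎_; inj₁; inj₂; [_,_]′)
open import Data.Unit.Base using (⊤; tt)
open import Function.Base using (_∘_; id; const)
open import Function.Bundles using (_⇔_; mk⇔; mk↔ₛ′; Equivalence; Inverse)
open import Function.Definitions using (Injective)
open import Level using (0ℓ)
open import Relation.Binary.Construct.Closure.ReflexiveTransitive using (ε; _◅_; _◅◅_)
open import Relation.Binary.Core using (Rel; _⇒_)
open import Relation.Binary.Definitions using (Symmetric; Irreflexive; tri<; tri≈; tri>)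
open import Relation.Binary.PropositionalEquality.Core
  using (_≡_; _≢_; refl; sym; trans; cong; subst; subst₂; ≢-sym)
open import Relation.Nullary.Decidable using (Dec; yes; no; map′; _×-dec_; _→-dec_; ¬?; decidable-stable)
open import Relation.Nullary.Negation using (¬_; contradiction)
open import Relation.Unary using (Decidable)

-- Minimal numbers and injections between finite sets.

least : ∀ {P : ℕ → Set} → Decidable P → ∀ {m} → P m →
        ∃ λ k → P k × (∀ j → P j → k ≤ j)
least P? {m} pm with P? 0
... | yes p₀ = 0 , p₀ , λ _ _ → z≤n
least P? {zero}  pm | no ¬p₀ = contradiction pm ¬p₀
least P? {suc m} pm | no ¬p₀ with least (P? ∘ suc) pm
... | k , pk , min = suc k , pk , λ where
  zero    p₀ → contradiction p₀ ¬p₀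
  (suc j) pj → s≤s (min j pj)

-- A missed value could be punched out, leaving an injection into a set with one element fewer.
injective⇒surjective : ∀ {n} {f : Fin n → Fin n} → Injective _≡_ _≡_ f →
                       ∀ y → ∃ λ x → f x ≡ y
injective⇒surjective {suc n} {f} inj y with any? (λ x → f x ≟ y)
... | yes found = found
... | no missed = contradiction
  (Fin.injective⇒≤ {f = punchOut ∘ y≢f} λ {x} {x′} → inj ∘ Fin.punchOut-injective (y≢f x) (y≢f x′))
  ℕ.1+n≰n
  where
  y≢f : ∀ x → y ≢ f x
  y≢f x y≡fx = missed (x , sym y≡fx)

-- Each punchOut frees the value of one element of ps; D x records that x has not yet been dropped.
squeeze : ∀ {A : Set} {k} (ps : List A) {D : A → Set}
          (g : ∀ x → D x → Fin (List.length ps + k)) →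
          (∀ x y d e → g x d ≡ g y e → x ≡ y) →
          All D ps → Unique ps →
          ∃ λ (h : ∀ x → D x → All (x ≢_) ps → Fin k) →
            ∀ x y d e a b → h x d a ≡ h y e b → x ≡ y
squeeze []       g inj _ _ = (λ x d _ → g x d) , λ x y d e _ _ → inj x y d e
squeeze {A} {k} (p ∷ ps) {D} g inj (dp ∷ dps) (p∉ps ∷ uniq) =
  (λ { x d (x≢p ∷ x∉ps) → proj₁ rec x (d , x≢p) x∉ps }) ,
  λ { x y d e (x≢p ∷ a) (y≢p ∷ b) → proj₂ rec x y (d , x≢p) (e , y≢p) a b }
  where
  g≢ : ∀ x (d : D x) → x ≢ p → g p dp ≢ g x d
  g≢ x d x≢p = x≢p ∘ sym ∘ inj p x dp d
  rec = squeeze {A} {k} ps {λ x → D x × x ≢ p}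
    (λ { x (d , x≢p) → punchOut (g≢ x d x≢p) })
    (λ { x y (d , x≢p) (e , y≢p) → inj x y d e ∘ Fin.punchOut-injective (g≢ x d x≢p) (g≢ y e y≢p) })
    (All.zip (dps , All.map ≢-sym p∉ps)) uniq

-- Colourings obtained by merging vertices.

module Merging {n : ℕ} (S : Rel (Fin n) 0ℓ) (S-sym : Symmetric S) (S-irrefl : Irreflexive _≡_ S) where

  -- A merge (p , q) gives p the colour of q.
  Merge : Set
  Merge = Fin n × Fin n

  Independent : Merge → Set
  Independent (p , q) = p ≢ q × ¬ S p q

  -- Together with `Independent` this keeps every source from being a target, so a class is one
  -- target with the sources sent to it. The last clause makes the sources of one class pairwise
  -- unrelated.
  Compatible : Rel Merge 0ℓ
  Compatible (p , q) (p′ , q′) = (p ≢ p′ × p ≢ q′ × p′ ≢ q) × (q ≡ q′ → ¬ S p p′)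

  representative : List Merge → Fin n → Fin n
  representative []             x = x
  representative ((p , q) ∷ ms) x with x ≟ p
  ... | yes _ = q
  ... | no  _ = representative ms x

  representative≢ : ∀ {z x} ms → z ≢ x → All (λ m → z ≢ proj₂ m) ms → z ≢ representative ms x
  representative≢         []             z≢x []           = z≢x
  representative≢ {x = x} ((p , q) ∷ ms) z≢x (z≢q ∷ z≢qs) with x ≟ p
  ... | yes _ = z≢q
  ... | no  _ = representative≢ ms z≢x z≢qs

  representative-misses : ∀ ms x → All Independent ms → AllPairs Compatible ms →
                          All (representative ms x ≢_) (List.map proj₁ ms)
  representative-misses []             x []               []       = []
  representative-misses ((p , q) ∷ ms) x ((p≢q , _) ∷ is) (c ∷ cs) with x ≟ p
  ... | yes _  = ≢-sym p≢q ∷ misses c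
    where
    misses : ∀ {ms} → All (Compatible (p , q)) ms → All (q ≢_) (List.map proj₁ ms)
    misses []                        = []
    misses (((_ , _ , p′≢q) , _) ∷ c) = ≢-sym p′≢q ∷ misses c
  ... | no x≢p =
    ≢-sym (representative≢ ms (≢-sym x≢p) (All.map (λ { ((_ , p≢q′ , _) , _) → p≢q′ }) c)) ∷
    representative-misses ms x is cs

  -- A vertex has representative `q` only if it is `q` itself or a source sent to `q`; the
  -- hypotheses exclude both for a vertex related to `p`.
  absorb : ∀ {p q y} ms → All (λ m → q ≡ proj₂ m → ¬ S p (proj₁ m)) ms → ¬ S p q →
           S p y → q ≢ representative ms y
  absorb         []               []        ¬Spq Spy refl = ¬Spq Spy
  absorb {y = y} ((p′ , q′) ∷ ms) (¬S ∷ ¬Ss) ¬Spq Spy with y ≟ p′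
  ... | yes refl = λ q≡q′ → ¬S q≡q′ Spy
  ... | no  _    = absorb ms ¬Ss ¬Spq Spy

  representative-separates : ∀ ms → All Independent ms → AllPairs Compatible ms →
                             ∀ {x y} → S x y → representative ms x ≢ representative ms y
  representative-separates []             []                _        Sxy = λ x≡y → S-irrefl x≡y Sxy
  representative-separates ((p , q) ∷ ms) ((_ , ¬Spq) ∷ is) (c ∷ cs) {x} {y} Sxy with x ≟ p | y ≟ p
  ... | yes refl | yes refl = λ _ → S-irrefl refl Sxy
  ... | yes refl | no _     = absorb ms (All.map proj₂ c) ¬Spq Sxy
  ... | no _     | yes refl = ≢-sym (absorb ms (All.map proj₂ c) ¬Spq (S-sym Sxy))
  ... | no _     | no _     = representative-separates ms is cs Sxy

  merge : ∀ {k} ms → n ≡ List.length ms + k → All Independent ms → AllPairs Compatible ms →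
          ∃ λ (c : Fin n → Fin k) → ∀ {x y} → S x y → c x ≢ c y
  merge {k} ms n≡ is cs =
    (λ x → proj₁ squeezed (representative ms x) tt (representative-misses ms x is cs)) ,
    λ Sxy → representative-separates ms is cs Sxy ∘ proj₂ squeezed _ _ tt tt _ _
    where
    length-proj₁ : ∀ ms → List.length (List.map proj₁ ms) ≡ List.length ms
    length-proj₁ []       = refl
    length-proj₁ (_ ∷ ms) = cong suc (length-proj₁ ms)
    n≡′ : n ≡ List.length (List.map proj₁ ms) + k
    n≡′ = trans n≡ (cong (_+ k) (sym (length-proj₁ ms)))
    uniq : ∀ {ms} → AllPairs Compatible ms → Unique (List.map proj₁ ms)
    uniq []       = []
    uniq {(p , q) ∷ _} (c ∷ cs) = heads c ∷ uniq cs
      where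
      heads : ∀ {ms} → All (Compatible (p , q)) ms → All (p ≢_) (List.map proj₁ ms)
      heads []                       = []
      heads (((p≢p′ , _) , _) ∷ c) = p≢p′ ∷ heads c
    squeezed = squeeze {k = k} (List.map proj₁ ms) {λ _ → ⊤}
      (λ x _ → Fin.cast n≡′ x)
      (λ x y _ _ → Fin.toℕ-injective ∘ λ e → trans (sym (Fin.toℕ-cast n≡′ x)) (trans (cong toℕ e) (Fin.toℕ-cast n≡′ y)))
      (All.universal (λ _ → tt) _) (uniq cs)

-- Two-colourings that separate two given pairs of vertices.

mark : ∀ {n} → Fin n → Fin n → Fin n → Fin 2
mark s t x with x ≟ s | x ≟ t
... | yes _ | _     = suc zero
... | no  _ | yes _ = suc zero
... | no  _ | no  _ = zero

mark-separates : ∀ {n} {s t x y : Fin n} → x ≡ s ⊎ x ≡ t → y ≢ s → y ≢ t → mark s t x ≢ mark s t y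
mark-separates {s = s} {t} {x} {y} x∈ y≢s y≢t with x ≟ s | x ≟ t | y ≟ s | y ≟ t
... | _        | _        | yes y≡s | _       = λ _ → y≢s y≡s
... | _        | _        | no  _   | yes y≡t = λ _ → y≢t y≡t
... | yes _    | _        | no  _   | no  _   = λ ()
... | no  _    | yes _    | no  _   | no  _   = λ ()
... | no  x≢s  | no x≢t   | no  _   | no  _   = λ _ → [ x≢s , x≢t ]′ x∈

-- One end of each pair is marked so that the other ends stay unmarked. The case `a ≡ c` with
-- `b ≢ e` falls under the last clause: the shared vertex stays unmarked.
two-colour-edges : ∀ {n} {a b c e : Fin n} → a ≢ b → c ≢ e →
                   ∃ λ (f : Fin n → Fin 2) → f a ≢ f b × f c ≢ f e
two-colour-edges {a = a} {b} {c} {e} a≢b c≢e with b ≟ c | b ≟ e | a ≟ e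
... | yes refl | _        | _        =
  mark b b , ≢-sym (mark-separates (inj₁ refl) a≢b a≢b) , mark-separates (inj₁ refl) (≢-sym c≢e) (≢-sym c≢e)
... | no _     | yes refl | _        =
  mark b b , ≢-sym (mark-separates (inj₁ refl) a≢b a≢b) , ≢-sym (mark-separates (inj₁ refl) c≢e c≢e)
... | no _     | no _     | yes refl =
  mark a a , mark-separates (inj₁ refl) (≢-sym a≢b) (≢-sym a≢b) , ≢-sym (mark-separates (inj₁ refl) c≢e c≢e)
... | no b≢c   | no b≢e   | no a≢e   =
  mark b e , ≢-sym (mark-separates (inj₁ refl) a≢b a≢e) , ≢-sym (mark-separates (inj₂ refl) (≢-sym b≢c) c≢e)

-- Walks, distance and geodesics.

module _ {n : ℕ} (G : Graph n) where
  open Graph G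

  len : ∀ {u v} → Walk G u v → ℕ
  len p = List.length (initVertices G p)

  len-◅◅ : ∀ {u v w} (p : Walk G u v) (q : Walk G v w) → len (p ◅◅ q) ≡ len p + len q
  len-◅◅ ε       q = refl
  len-◅◅ (_ ◅ p) q = cong suc (len-◅◅ p q)

  reverse-walk : ∀ {u v} (p : Walk G u v) → ∃ λ (q : Walk G v u) → len q ≡ len p
  reverse-walk ε       = ε , refl
  reverse-walk (e ◅ p) with reverse-walk p
  ... | q , ∣q∣ = q ◅◅ (~-sym e ◅ ε) ,
                  trans (len-◅◅ q _) (trans (ℕ.+-comm _ 1) (cong suc ∣q∣))

  -- Turns properness into a condition on `initVertices`, the list that `walk?` inspects.
  internal≡drop : ∀ {u v} (p : Walk G u v) → internalVertices G p ≡ drop 1 (initVertices G p)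
  internal≡drop ε       = refl
  internal≡drop (_ ◅ _) = refl

  -- Fixing the length makes the search finite. It serves both distances, with a trivial `Q`, and
  -- vertex-proper geodesics.
  walk? : ∀ {Q : List (Fin n) → Set} → Decidable Q → ∀ k u v →
          Dec (∃ λ (p : Walk G u v) → len p ≡ k × Q (initVertices G p))
  walk? Q? zero u v = map′ (λ { (refl , q) → ε , refl , q }) (λ { (ε , _ , q) → refl , q })
    (u ≟ v ×-dec Q? [])
  walk? Q? (suc k) u v = map′
    (λ { (x , e , p , ∣p∣ , q) → e ◅ p , cong suc ∣p∣ , q })
    (λ { (e ◅ p , ∣p∣ , q) → _ , e , p , ℕ.suc-injective ∣p∣ , q })
    (any? λ x → (u ~? x) ×-dec walk? (Q? ∘ (u ∷_)) k x v)

  suffix : ∀ {u x v} (p : Walk G x v) → u ∈ vertices G p → ∃ λ (q : Walk G u v) → len q ≤ len p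
  suffix ε       (here refl) = ε , z≤n
  suffix (e ◅ p) (here refl) = e ◅ p , ≤-refl
  suffix (e ◅ p) (there u∈p) with suffix p u∈p
  ... | q , q≤p = q , ℕ.m≤n⇒m≤1+n q≤p

  linked-vertices : ∀ {R : Rel (Fin n) 0ℓ} → (∀ {x y} → x ~ y → R x y) →
                    ∀ {u v} (p : Walk G u v) → Linked R (initVertices G p)
  linked-vertices ~⇒R ε            = []
  linked-vertices ~⇒R (_ ◅ ε)      = [-]
  linked-vertices ~⇒R (e ◅ f ◅ p) = ~⇒R e ∷ linked-vertices ~⇒R (f ◅ p)

  module Distance (conn : Connected G) where

    opaque
      shortest : ∀ u v → ∃ λ k → (∃ λ (p : Walk G u v) → len p ≡ k × ⊤) ×
                                 (∀ j → (∃ λ (p : Walk G u v) → len p ≡ j × ⊤) → k ≤ j)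
      shortest u v = least (λ k → walk? (λ _ → yes tt) k u v) (proj₁ (conn u v) , refl , tt)

    dist : Fin n → Fin n → ℕ
    dist u v = proj₁ (shortest u v)

    dist-walk : ∀ u v → ∃ λ (p : Walk G u v) → len p ≡ dist u v
    dist-walk u v with p , ∣p∣ , _ ← proj₁ (proj₂ (shortest u v)) = p , ∣p∣

    dist≤len : ∀ {u v} (p : Walk G u v) → dist u v ≤ len p
    dist≤len p = proj₂ (proj₂ (shortest _ _)) _ (p , refl , tt)

    dist-sym : ∀ u v → dist u v ≡ dist v u
    dist-sym u v = ≤-antisym (half u v) (half v u)
      where
      half : ∀ u v → dist u v ≤ dist v u
      half u v with p , ∣p∣ ← dist-walk v u with q , ∣q∣ ← reverse-walk p =
        ≤-trans (dist≤len q) (≤-reflexive (trans ∣q∣ ∣p∣))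

    dist-refl : ∀ u → dist u u ≡ 0
    dist-refl u = ℕ.n≤0⇒n≡0 (dist≤len ε)

    dist≡0⇒≡ : ∀ {u v} → dist u v ≡ 0 → u ≡ v
    dist≡0⇒≡ {u} {v} d with dist-walk u v
    ... | ε     , _   = refl
    ... | _ ◅ _ , ∣p∣ = contradiction (trans ∣p∣ d) λ ()

    dist-~ : ∀ {x y} u → x ~ y → dist x u ≤ suc (dist y u)
    dist-~ {y = y} u e with p , ∣p∣ ← dist-walk y u = ≤-trans (dist≤len (e ◅ p)) (s≤s (≤-reflexive ∣p∣))

    predecessor : ∀ {x u k} → dist x u ≡ suc k → ∃ λ y → x ~ y × dist y u ≡ k
    predecessor {x} {u} d with dist-walk x u
    ... | ε     , ∣p∣ = contradiction (trans ∣p∣ d) λ ()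
    ... | e ◅ p , ∣p∣ = _ , e , ≤-antisym
      (≤-trans (dist≤len p) (≤-reflexive (ℕ.suc-injective (trans ∣p∣ d))))
      (s≤s⁻¹ (≤-trans (≤-reflexive (sym d)) (dist-~ u e)))

    dist≡1⇒~ : ∀ {x u} → dist x u ≡ 1 → x ~ u
    dist≡1⇒~ d with y , e , d′ ← predecessor d with refl ← dist≡0⇒≡ d′ = e

    opaque
      -- Each step to a `predecessor` lowers the distance to `u` by exactly one, so no value is
      -- skipped.
      level : ∀ {v u k} → k ≤ dist v u → ∃ λ x → dist x u ≡ k
      level {v} {u} {k} k≤d = go (dist v u) refl (ℕ.m∸n+n≡m k≤d)
        where
        go : ∀ j {x} → dist x u ≡ j → ∀ {i} → i + k ≡ j → ∃ λ x → dist x u ≡ k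
        go j       d {zero}  refl = _ , d
        go (suc j) d {suc i} i+k≡j with y , _ , d′ ← predecessor d = go j d′ (ℕ.suc-injective i+k≡j)

    -- The values from 0 to `dist v u` all occur as distances to `u`, at different vertices.
    dist<n : ∀ v u → dist v u < n
    dist<n v u = Fin.injective⇒≤ {f = λ i → proj₁ (at i)} λ {i} {j} e →
      Fin.toℕ-injective (trans (sym (proj₂ (at i))) (trans (cong (λ x → dist x u) e) (proj₂ (at j))))
      where
      at : ∀ (i : Fin (suc (dist v u))) → ∃ λ x → dist x u ≡ toℕ i
      at i = level (Fin.toℕ≤pred[n] i)

    none>⇒dist≤ : ∀ {m} → ¬ (∃₂ λ x y → m < dist x y) → ∀ x y → dist x y ≤ m
    none>⇒dist≤ none x y = ℕ.≮⇒≥ λ m<d → none (x , y , m<d)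

    closer⇒≢ : ∀ {x y} u → dist x u < dist y u → x ≢ y
    closer⇒≢ u x<y refl = ℕ.<-irrefl refl x<y

    much-closer⇒≁ : ∀ {x y} u → 2 + dist x u ≤ dist y u → ¬ y ~ x
    much-closer⇒≁ u x<y e = ℕ.<-irrefl refl (≤-trans x<y (dist-~ u e))

    -- If the start recurred, the suffix from there would be a shorter walk. The tail is again
    -- shortest, since distance drops by at most one along an edge.
    shortest-unique : ∀ {u v} (p : Walk G u v) → len p ≡ dist u v → Unique (vertices G p)
    shortest-unique ε _ = [] ∷ []
    shortest-unique {u} {v} (_◅_ {j = x} e p) ∣p∣ =
      ¬Any⇒All¬ _ (λ u∈p → let q , q≤p = suffix p u∈p in
        ℕ.<-irrefl refl (≤-trans (s≤s q≤p) (≤-trans (≤-reflexive ∣p∣) (dist≤len q)))) ∷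
      shortest-unique p (≤-antisym (s≤s⁻¹ (≤-trans (≤-reflexive ∣p∣) (dist-~ v e))) (dist≤len p))

    geodesic : ∀ {u v} (p : Walk G u v) → len p ≡ dist u v → ∃ λ (q : Path G u v) → proj₁ q ≡ p × IsGeodesic G q
    geodesic p ∣p∣ = q , refl , (q , refl) , λ r → ≤-trans (≤-reflexive ∣p∣) (dist≤len (proj₁ r))
      where q = p , shortest-unique p ∣p∣

    geodesic-length : ∀ {u v} (p : Path G u v) → IsGeodesic G p → len (proj₁ p) ≡ dist u v
    geodesic-length {u} {v} p (_ , min) with q , ∣q∣ ← dist-walk u v =
      ≤-antisym (≤-trans (min (q , shortest-unique q ∣q∣)) (≤-reflexive ∣q∣)) (dist≤len (proj₁ p))

    -- Criteria for strong proper colourings, and their decidability.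

    module _ {k} (c : Colouring G k) where

      Separates : Rel (Fin n) 0ℓ
      Separates x y = c x ≢ c y

      -- Geodesics are exactly the walks of length `dist u v`, so searching the walks of that length
      -- is enough.
      strongProper? : Dec (StrongProperVertexConnected G c)
      strongProper? = all? λ u → all? λ v → map′
        (λ { (p , ∣p∣ , proper) → let q , q≡p , geo = geodesic p ∣p∣ in
             q , geo , subst (Linked Separates) (trans (sym (internal≡drop p)) (cong (internalVertices G) (sym q≡p))) proper })
        (λ { (p , geo , proper) →
             proj₁ p , geodesic-length p geo , subst (Linked Separates) (internal≡drop (proj₁ p)) proper })
        (walk? (λ xs → Linked.linked? (λ x y → ¬? (c x ≟ c y)) (drop 1 xs)) (dist u v) u v)

      fromWalks : (∀ u v → ∃ λ (p : Walk G u v) → len p ≡ dist u v × Linked Separates (internalVertices G p)) →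
                  StrongProperVertexConnected G c
      fromWalks walks u v with p , ∣p∣ , proper ← walks u v with q , refl , geo ← geodesic p ∣p∣ = q , geo , proper

      proper-colouring : (∀ {x y} → x ~ y → c x ≢ c y) → StrongProperVertexConnected G c
      proper-colouring ~⇒≢ = fromWalks λ u v → let p , ∣p∣ = dist-walk u v in p , ∣p∣ , proper p
        where
        proper : ∀ {u v} (p : Walk G u v) → Linked Separates (internalVertices G p)
        proper ε       = []
        proper (_ ◅ p) = linked-vertices ~⇒≢ p

      SeparatedThreeWalk : Rel (Fin n) 0ℓ
      SeparatedThreeWalk x y = ∃₂ λ w z → x ~ w × w ~ z × z ~ y × c w ≢ c z

      SeparatedThreeWalk-sym : Symmetric SeparatedThreeWalk
      SeparatedThreeWalk-sym (w , z , e , f , g , sep) = z , w , ~-sym g , ~-sym f , ~-sym e , ≢-sym sep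

      -- A walk of length at most 2 has at most one internal vertex, so only the middle edges of
      -- geodesics of length 3 matter.
      diameter≤3 : (∀ u v → dist u v ≤ 2 ⊎ dist u v ≡ 3 × SeparatedThreeWalk u v) →
                   StrongProperVertexConnected G c
      diameter≤3 near = fromWalks walks
        where
        short : ∀ {u v} (p : Walk G u v) → len p ≤ 2 → Linked Separates (internalVertices G p)
        short ε               _             = []
        short (_ ◅ ε)         _             = []
        short (_ ◅ _ ◅ ε)     _             = [-]
        short (_ ◅ _ ◅ _ ◅ _) (s≤s (s≤s ()))
        walks : ∀ u v → ∃ λ (p : Walk G u v) → len p ≡ dist u v × Linked Separates (internalVertices G p)
        walks u v with near u v
        ... | inj₂ (d , w , z , e , f , g , sep) = e ◅ f ◅ g ◅ ε , sym d , sep ∷ [-]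
        ... | inj₁ d≤2 with p , ∣p∣ ← dist-walk u v = p , ∣p∣ , short p (≤-trans (≤-reflexive ∣p∣) d≤2)

    sufficientColours? : Decidable (SufficientColours G)
    sufficientColours? zero    = all? λ u → all? λ v → ¬? (u ≟ v) →-dec (u ~? v)
    sufficientColours? (suc k) = map′
      (λ { (i , spvc) → finToFun i , spvc })
      -- Colourings are enumerated by their codes; decoding the code of `c` agrees with `c` only
      -- pointwise, so properness is carried over.
      (λ { (c , spvc) → funToFin c , λ u v → let p , geo , proper = spvc u v in
           p , geo , Linked.map (λ ≢ → ≢ ∘ λ e → trans (sym (Fin.finToFun-funToFin c _)) (trans e (Fin.finToFun-funToFin c _))) proper })
      (any? λ i → strongProper? (finToFun {suc k} {n} i))

  sufficientColours-mono : ∀ {j k} → suc j ≤ k → SufficientColours G (suc j) → SufficientColours G k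
  sufficientColours-mono {k = suc k} j≤k (c , spvc) = (λ x → inject≤ (c x) j≤k) , λ u v →
    let p , geo , proper = spvc u v in
    p , geo , Linked.map (λ ≢ → ≢ ∘ Fin.inject≤-injective j≤k j≤k _ _) proper

-- Graphs whose diameter is one less than their order.

module _ {e : ℕ} (G : Graph (suc e)) (conn : Connected G) where
  open Graph G
  open Distance G conn

  -- All `suc e` possible distances to `u` occur, so distance to `u` is a bijection. Adjacent
  -- vertices then differ in distance by exactly one, and the `predecessor` of a vertex is the only
  -- vertex one step closer.
  diametral⇒path : ∀ {v u} → dist v u ≡ e → G ≅ P (suc e)
  diametral⇒path {v} {u} d = record
    { bijection = mk↔ₛ′ to from to∘from from∘to
    ; adjacency = λ x y → mk⇔ (adjacent⇒consecutive x y) (consecutive⇒adjacent x y)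
    }
    where
    to : Fin (suc e) → Fin (suc e)
    to x = fromℕ< (dist<n x u)
    toℕ-to : ∀ x → toℕ (to x) ≡ dist x u
    toℕ-to x = Fin.toℕ-fromℕ< (dist<n x u)
    at : ∀ (i : Fin (suc e)) → ∃ λ x → dist x u ≡ toℕ i
    at i = level (≤-trans (Fin.toℕ≤pred[n] i) (≤-reflexive (sym d)))
    from : Fin (suc e) → Fin (suc e)
    from i = proj₁ (at i)
    to∘from : ∀ i → to (from i) ≡ i
    to∘from i = Fin.toℕ-injective (trans (toℕ-to (from i)) (proj₂ (at i)))
    from-injective : Injective _≡_ _≡_ from
    from-injective {i} {j} eq = trans (sym (to∘from i)) (trans (cong to eq) (to∘from j))
    from∘to : ∀ x → from (to x) ≡ x
    from∘to x = let i , fromi≡x = injective⇒surjective from-injective x in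
      trans (cong (from ∘ to) (sym fromi≡x)) (trans (cong from (to∘from i)) fromi≡x)
    dist-injective : ∀ {x y} → dist x u ≡ dist y u → x ≡ y
    dist-injective {x} {y} eq = trans (sym (from∘to x)) (trans (cong from
      (Fin.toℕ-injective (trans (toℕ-to x) (trans eq (sym (toℕ-to y)))))) (from∘to y))
    adjacent⇒consecutive : ∀ x y → x ~ y → Graph._~_ (P (suc e)) (to x) (to y)
    adjacent⇒consecutive x y x~y with ℕ.<-cmp (dist x u) (dist y u)
    ... | tri< x<y _ _ = inj₁ (trans (cong suc (toℕ-to x))
            (trans (≤-antisym x<y (dist-~ u (~-sym x~y))) (sym (toℕ-to y))))
    ... | tri≈ _ x≡y _ = contradiction x~y (~-irrefl (dist-injective x≡y))
    ... | tri> _ _ y<x = inj₂ (trans (cong suc (toℕ-to y))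
            (trans (≤-antisym y<x (dist-~ u x~y)) (sym (toℕ-to x))))
    step : ∀ x y → suc (toℕ (to x)) ≡ toℕ (to y) → y ~ x
    step x y eq = let z , y~z , d′ = predecessor (trans (sym (toℕ-to y)) (sym eq)) in
      subst (y ~_) (dist-injective (trans d′ (toℕ-to x))) y~z
    consecutive⇒adjacent : ∀ x y → Graph._~_ (P (suc e)) (to x) (to y) → x ~ y
    consecutive⇒adjacent x y (inj₁ eq) = ~-sym (step x y eq)
    consecutive⇒adjacent x y (inj₂ eq) = step y x eq

-- Colours for paths, and what 0 or 1 colours imply.

parity : ℕ → Fin 2
parity zero    = zero
parity (suc n) = opposite (parity n)

opposite≢ : ∀ (i : Fin 2) → i ≢ opposite i
opposite≢ zero       ()
opposite≢ (suc zero) ()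

path⇒2-colours : ∀ {n m} (G : Graph n) → Connected G → G ≅ P m → SufficientColours G 2
path⇒2-colours {n} {m} G conn G≅P = c , Distance.proper-colouring G conn c λ {x} {y} x~y →
  consecutive (Equivalence.to (_≅_.adjacency G≅P x y) x~y)
  where
  open Inverse (_≅_.bijection G≅P) using (to)
  c : Fin n → Fin 2
  c x = parity (toℕ (to x))
  consecutive : ∀ {i j} → Graph._~_ (P m) i j → parity (toℕ i) ≢ parity (toℕ j)
  consecutive {i} (inj₁ eq) rewrite sym eq = opposite≢ (parity (toℕ i))
  consecutive {j = j} (inj₂ eq) rewrite sym eq = ≢-sym (opposite≢ (parity (toℕ j)))

WalksWithin : ∀ {n} → Graph n → ℕ → Set
WalksWithin G d = ∀ u v → ∃ λ (p : Walk G u v) → len G p ≤ d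

-- Position on the path grows by at most one per edge, so a walk from end to end has length at least
-- `m`.
path-width : ∀ {n m d} (G : Graph n) → G ≅ P (suc m) → WalksWithin G d → m ≤ d
path-width {m = m} {d} G G≅P within = subst₂ _≤_ (Fin.toℕ-fromℕ m) (ℕ.+-identityʳ d)
  (subst₂ (λ i j → toℕ j ≤ d + toℕ i) (strictlyInverseˡ zero) (strictlyInverseˡ (fromℕ m)) far)
  where
  open Inverse (_≅_.bijection G≅P)
  climb : ∀ {u v} (p : Walk G u v) → toℕ (to v) ≤ len G p + toℕ (to u)
  climb ε = ≤-refl
  climb {u} {v} (_◅_ {j = x} e p) with Equivalence.to (_≅_.adjacency G≅P u x) e
  ... | inj₁ eq = ≤-trans (climb p) (≤-reflexive (trans (cong (len G p +_) (sym eq)) (ℕ.+-suc _ _)))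
  ... | inj₂ eq = ≤-trans (climb p) (≤-trans (ℕ.+-monoʳ-≤ (len G p) (≤-trans (ℕ.n≤1+n _) (≤-reflexive eq))) (ℕ.n≤1+n _))
  far : toℕ (to (from (fromℕ m))) ≤ d + toℕ (to (from zero))
  far with p , p≤d ← within (from zero) (from (fromℕ m)) = ≤-trans (climb p) (ℕ.+-monoˡ-≤ _ p≤d)

0-colours⇒within-1 : ∀ {n} (G : Graph n) → SufficientColours G 0 → WalksWithin G 1
0-colours⇒within-1 G complete u v with u ≟ v
... | yes refl = ε , z≤n
... | no u≢v   = complete u v u≢v ◅ ε , ≤-refl

1-colour⇒within-2 : ∀ {n} (G : Graph n) → SufficientColours G 1 → WalksWithin G 2
1-colour⇒within-2 G (c , spvc) u v with (p , _) , _ , proper ← spvc u v = p , bound p proper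
  where
  one : ∀ (i j : Fin 1) → i ≡ j
  one zero zero = refl
  bound : ∀ {u v} (p : Walk G u v) → Linked (λ x y → c x ≢ c y) (internalVertices G p) → len G p ≤ 2
  bound ε               _       = z≤n
  bound (_ ◅ ε)         _       = s≤s z≤n
  bound (_ ◅ _ ◅ ε)     _       = ≤-refl
  -- Such a walk has two adjacent internal vertices, which a single colour cannot separate.
  bound (_ ◅ _ ◅ _ ◅ _) (≢ ∷ _) = contradiction (one _ _) ≢

-- Three colours saved by classes chosen by distance from a vertex.

module _ {k : ℕ} (G : Graph (3 + k)) (conn : Connected G) where
  open Graph G
  open Distance G conn

  -- The classes are {u , b}, {c , r} and {c′ , r′}, joined into larger ones when the targets coincide.
  ladder-colouring : (S : Rel (Fin (3 + k)) 0ℓ) → Symmetric S → S ⇒ _~_ →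
    ∀ {u b c c′ r r′} → dist b u ≡ 2 → 3 ≤ dist c u → 3 ≤ dist c′ u →
    1 ≤ dist r u → dist r u ≤ 2 → 1 ≤ dist r′ u → dist r′ u ≤ 2 →
    c ≢ c′ → ¬ S c r → ¬ S c′ r′ → (r ≡ r′ → ¬ S c c′) →
    ∃ λ (f : Colouring G k) → ∀ {x y} → S x y → f x ≢ f y
  ladder-colouring S S-sym S⇒~ {u} {b} {c} {c′} {r} {r′} b₂ c₃ c′₃ r₁ r₂ r′₁ r′₂ c≢c′ ¬Scr ¬Sc′r′ ¬Scc′ =
    merge ((u , b) ∷ (c , r) ∷ (c′ , r′) ∷ []) refl
      ((u≢ (ℕ.<⇒≤ (≤-reflexive (sym b₂))) , λ Sub → much-closer⇒≁ u (≤-reflexive (trans (cong (2 +_) (dist-refl u)) (sym b₂))) (~-sym (S⇒~ Sub))) ∷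
       (≢-sym (r≢c r₂ c₃) , ¬Scr) ∷ (≢-sym (r≢c r′₂ c′₃) , ¬Sc′r′) ∷ [])
      ((u-vs c₃ r₁ ∷ u-vs c′₃ r′₁ ∷ []) ∷
       (((c≢c′ , ≢-sym (r≢c r′₂ c₃) , ≢-sym (r≢c r₂ c′₃)) , ¬Scc′) ∷ []) ∷ [] ∷ [])
    where
    open Merging S S-sym (λ x≡y Sxy → ~-irrefl x≡y (S⇒~ Sxy))
    u≢ : ∀ {x} → 1 ≤ dist x u → u ≢ x
    u≢ x₁ = closer⇒≢ u (≤-trans (≤-reflexive (cong suc (dist-refl u))) x₁)
    r≢c : ∀ {r c} → dist r u ≤ 2 → 3 ≤ dist c u → r ≢ c
    r≢c r₂ c₃ = closer⇒≢ u (≤-trans (s≤s r₂) c₃)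
    u-vs : ∀ {c r} → 3 ≤ dist c u → 1 ≤ dist r u → Compatible (u , b) (c , r)
    u-vs c₃ r₁ = (u≢ (≤-trans (s≤s z≤n) c₃) , u≢ r₁ , ≢-sym (r≢c (≤-reflexive b₂) c₃)) ,
      -- If `r` is `b`, then `u` and `c` share a class; they are nonadjacent because `c` is at
      -- distance at least 3.
      λ _ Suc → much-closer⇒≁ u (≤-trans (≤-reflexive (cong (2 +_) (dist-refl u))) (≤-trans (s≤s (s≤s z≤n)) c₃)) (~-sym (S⇒~ Suc))

-- `SufficientColours` without the convention at 0, so that the number of colours can be a variable;
-- at a successor the two agree by computation.
ProperColours : ∀ {n} → Graph n → ℕ → Set
ProperColours G k = ∃ λ (c : Colouring G k) → StrongProperVertexConnected G c

-- Pairs of vertices at distance 3.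

module _ {n : ℕ} (G : Graph n) (conn : Connected G) where
  open Graph G
  open Distance G conn

  Far : Rel (Fin n) 0ℓ
  Far x y = dist x y ≡ 3

  Far-sym : Symmetric Far
  Far-sym {x} {y} = trans (dist-sym y x)

  Far⇒≢ : ∀ {x y} → Far x y → x ≢ y
  Far⇒≢ {x} far refl = contradiction (trans (sym far) (dist-refl x)) λ ()

  Far⇒≁ : ∀ {x y} → Far x y → ¬ x ~ y
  Far⇒≁ far x~y = contradiction (≤-trans (≤-reflexive (sym far)) (dist≤len (x~y ◅ ε))) λ { (s≤s ()) }

  far-walk : ∀ {x y} → Far x y → ∃₂ λ w z → x ~ w × w ~ z × z ~ y
  far-walk far with w , e , d ← predecessor far with z , f , d′ ← predecessor d = w , z , e , f , dist≡1⇒~ d′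

  ≤3⇒≤2⊎≡3 : ∀ {d} → d ≤ 3 → d ≤ 2 ⊎ d ≡ 3
  ≤3⇒≤2⊎≡3 d≤3 with ℕ.m≤n⇒m<n∨m≡n d≤3
  ... | inj₁ d<3 = inj₁ (s≤s⁻¹ d<3)
  ... | inj₂ d≡3 = inj₂ d≡3

  far-separated : ∀ {k} (c : Colouring G k) → (∀ x y → dist x y ≤ 3) →
                  (∀ {x y} → Far x y → SeparatedThreeWalk c x y) → StrongProperVertexConnected G c
  far-separated c ≤3 sep = diameter≤3 c near
    where
    near : ∀ x y → dist x y ≤ 2 ⊎ Far x y × SeparatedThreeWalk c x y
    near x y with ≤3⇒≤2⊎≡3 (≤3 x y)
    ... | inj₁ ≤2  = inj₁ ≤2
    ... | inj₂ far = inj₂ (far , sep far)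

  FarMatching : Set
  FarMatching = ∀ {u v w} → Far v u → Far w u → v ≡ w

  module _ (match : FarMatching) where

    partner≢ : ∀ {u v x y} → Far u v → Far x y → x ≢ u → x ≢ v → y ≢ u × y ≢ v
    partner≢ uv xy x≢u x≢v =
      (λ { refl → x≢v (match xy (Far-sym uv)) }) , λ { refl → x≢u (match xy uv) }

    -- The two given pairs may coincide, which covers a single pair. By `match` a listed vertex
    -- determines its partner, so two bichromatic middle edges serve every far pair.
    one-or-two-pairs : (∀ x y → dist x y ≤ 3) → ∀ {u v x y} → Far u v → Far x y →
                       (∀ {s t} → Far s t → s ∈ u ∷ v ∷ x ∷ y ∷ []) → ProperColours G 2
    one-or-two-pairs ≤3 {u} {v} {x} {y} uv xy only
      with a , b , u~a , a~b , b~v ← far-walk uv with c , e , x~c , c~e , e~y ← far-walk xy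
      with f , fa≢fb , fc≢fe ← two-colour-edges (λ a≡b → ~-irrefl a≡b a~b) (λ c≡e → ~-irrefl c≡e c~e)
      = f , far-separated f ≤3 λ st → separated st (only st)
      where
      u⋯v : SeparatedThreeWalk f u v
      u⋯v = a , b , u~a , a~b , b~v , fa≢fb
      x⋯y : SeparatedThreeWalk f x y
      x⋯y = c , e , x~c , c~e , e~y , fc≢fe
      from : ∀ {s t t′} → SeparatedThreeWalk f s t → Far s t → Far s t′ → SeparatedThreeWalk f s t′
      from {s} walk st st′ = subst (SeparatedThreeWalk f s) (match (Far-sym st) (Far-sym st′)) walk
      separated : ∀ {s t} → Far s t → s ∈ u ∷ v ∷ x ∷ y ∷ [] → SeparatedThreeWalk f s t
      separated st (here refl)                         = from u⋯v uv st
      separated st (there (here refl))                 = from (SeparatedThreeWalk-sym f u⋯v) (Far-sym uv) st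
      separated st (there (there (here refl)))         = from x⋯y xy st
      separated st (there (there (there (here refl)))) = from (SeparatedThreeWalk-sym f x⋯y) (Far-sym xy) st

    -- By `match` the pairs are disjoint as soon as `x` and `s` are new, and far vertices are
    -- nonadjacent, so the pairs are three independent classes.
    three-pairs : ∀ {k} → n ≡ 3 + k → ∀ {u v x y s t} → Far u v → Far x y → Far s t →
                  x ∉ u ∷ v ∷ [] → s ∉ u ∷ v ∷ x ∷ y ∷ [] → ProperColours G k
    three-pairs n≡ {u} {v} {x} {y} {s} {t} uv xy st x∉ s∉ =
      let f , proper = merge ((u , v) ∷ (x , y) ∷ (s , t) ∷ []) n≡
            ((Far⇒≢ uv , Far⇒≁ uv) ∷ (Far⇒≢ xy , Far⇒≁ xy) ∷ (Far⇒≢ st , Far⇒≁ st) ∷ [])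
            ((compatible uv xy (x∉ ∘ here) (x∉ ∘ there ∘ here) ∷
              compatible uv st (s∉ ∘ here) (s∉ ∘ there ∘ here) ∷ []) ∷
             (compatible xy st (s∉ ∘ there ∘ there ∘ here) (s∉ ∘ there ∘ there ∘ there ∘ here) ∷ []) ∷ [] ∷ [])
      in f , proper-colouring f proper
      where
      open Merging _~_ ~-sym ~-irrefl
      compatible : ∀ {u v x y} → Far u v → Far x y → x ≢ u → x ≢ v → Compatible (u , v) (x , y)
      compatible uv xy x≢u x≢v with y≢u , y≢v ← partner≢ uv xy x≢u x≢v =
        (≢-sym x≢u , ≢-sym y≢u , x≢v) , λ v≡y → contradiction (sym v≡y) y≢v

-- n - 3 colours for n ≥ 5 and diameter at least 3.

module _ {k : ℕ} (G : Graph (5 + k)) (conn : Connected G) where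
  open Graph G
  open Distance G conn

  diameter≥4⇒n-3 : ∀ {v u} → 4 ≤ dist v u → ProperColours G (2 + k)
  diameter≥4⇒n-3 {v} {u} ≥4
    with y₄ , d₄ ← level ≥4 with y₃ , e₃ , d₃ ← predecessor d₄
    with y₂ , e₂ , d₂ ← predecessor d₃ with y₁ , e₁ , d₁ ← predecessor d₂ =
    -- Here `b` and `r` are both `y₂`, so `y₄` joins the class of `u` and `y₂`; the other class is
    -- `y₃` with `y₁`.
    let f , proper = ladder-colouring G conn _~_ ~-sym id {u} {y₂} {y₄} {y₃} {y₂} {y₁} d₂
          (≥ d₄ (s≤s (s≤s (s≤s z≤n)))) (≥ d₃ ≤-refl) (≥ d₂ (s≤s z≤n)) (≤-reflexive d₂)
          (≥ d₁ ≤-refl) (≤-trans (≤-reflexive d₁) (s≤s z≤n))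
          (≢-sym (closer⇒≢ u (≤-reflexive (trans (cong suc d₃) (sym d₄)))))
          (much-closer⇒≁ u (≤-reflexive (trans (cong (2 +_) d₂) (sym d₄))))
          (much-closer⇒≁ u (≤-reflexive (trans (cong (2 +_) d₁) (sym d₃))))
          (λ y₂≡y₁ → contradiction (sym y₂≡y₁) (closer⇒≢ u (≤-reflexive (trans (cong suc d₁) (sym d₂)))))
    in f , proper-colouring f proper
    where
    ≥ : ∀ {x d m} → dist x u ≡ d → m ≤ d → m ≤ dist x u
    ≥ refl m≤d = m≤d

  -- The clique condition is conditional on `c ~ c′`, so that a nonadjacent pair and a clique are
  -- handled by one lemma.
  two-far⇒n-3 : (∀ x y → dist x y ≤ 3) → ∀ {u c c′} → Far G conn c u → Far G conn c′ u → c ≢ c′ →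
                (c ~ c′ → ∀ {x y} → Far G conn x u → Far G conn y u → x ≢ y → x ~ y) → ProperColours G (2 + k)
  two-far⇒n-3 ≤3 {u} {c} {c′} c₃ c′₃ c≢c′ clique
    with b , c~b , b₂ ← predecessor c₃ with a , b~a , a₁ ← predecessor b₂ = result
    where
    a~u : a ~ u
    a~u = dist≡1⇒~ a₁
    ≁a : ∀ {x a} → dist a u ≡ 1 → Far G conn x u → ¬ x ~ a
    ≁a a₁ x₃ = much-closer⇒≁ u (≤-reflexive (trans (cong (2 +_) a₁) (sym x₃)))
    ladder : (S : Rel (Fin (5 + k)) 0ℓ) → Symmetric S → S ⇒ _~_ → ∀ {a′} → dist a′ u ≡ 1 →
             (a ≡ a′ → ¬ S c c′) → ∃ λ (f : Colouring G (2 + k)) → ∀ {x y} → S x y → f x ≢ f y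
    ladder S S-sym S⇒~ a′₁ ¬Scc′ = ladder-colouring G conn S S-sym S⇒~ b₂
      (≤-reflexive (sym c₃)) (≤-reflexive (sym c′₃))
      (≤-reflexive (sym a₁)) (≤-trans (≤-reflexive a₁) (s≤s z≤n))
      (≤-reflexive (sym a′₁)) (≤-trans (≤-reflexive a′₁) (s≤s z≤n))
      c≢c′ (≁a a₁ c₃ ∘ S⇒~) (≁a a′₁ c′₃ ∘ S⇒~) ¬Scc′
    fromProper : (∃ λ (f : Colouring G (2 + k)) → ∀ {x y} → x ~ y → f x ≢ f y) → ProperColours G (2 + k)
    fromProper (f , proper) = f , proper-colouring f proper
    -- Dropping the edges among vertices at distance 3 from `u` makes `a`, `c`, `c′` independent
    -- even when `c ~ c′`.
    OutsideL₃ : Rel (Fin (5 + k)) 0ℓ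
    OutsideL₃ x y = x ~ y × ¬ (Far G conn x u × Far G conn y u)

    -- The colouring need not be proper, since `c` and `c′` may be adjacent with equal colours.
    -- Every vertex at distance 2 from `u` is adjacent to `a`, which provides detours.
    pendant : c ~ c′ → (∀ {x} → dist x u ≡ 1 → x ≡ a) → ProperColours G (2 + k)
    pendant c~c′ only-a with f , separates ← ladder OutsideL₃
      (λ (x~y , ¬L₃) → ~-sym x~y , λ (y₃ , x₃) → ¬L₃ (x₃ , y₃)) proj₁ a₁ (λ _ (_ , ¬L₃) → ¬L₃ (c₃ , c′₃))
      = f , far-separated G conn f ≤3 separated
      where
      ≥2⇒≡2⊎≡3 : ∀ {x} → 2 ≤ dist x u → dist x u ≡ 2 ⊎ Far G conn x u
      ≥2⇒≡2⊎≡3 {x} ≥2 with ≤3⇒≤2⊎≡3 G conn (≤3 x u)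
      ... | inj₁ ≤2 = inj₁ (≤-antisym ≤2 ≥2)
      ... | inj₂ ≡3 = inj₂ ≡3
      beside-L₃ : ∀ {x w} → x ~ w → Far G conn w u → dist x u ≡ 2 ⊎ Far G conn x u
      beside-L₃ x~w w₃ = ≥2⇒≡2⊎≡3 (s≤s⁻¹ (≤-trans (≤-reflexive (sym w₃)) (dist-~ u (~-sym x~w))))
      ~a : ∀ {x} → dist x u ≡ 2 → x ~ a
      ~a x₂ with z , x~z , z₁ ← predecessor x₂ = subst (_ ~_) (only-a z₁) x~z
      via-a : ∀ {x y} → dist x u ≡ 2 → Far G conn y u → SeparatedThreeWalk f x y
      via-a x₂ y₃ with b′ , y~b′ , b′₂ ← predecessor y₃ =
        a , b′ , ~a x₂ , ~-sym (~a b′₂) , ~-sym y~b′ , separates (~-sym (~a b′₂) , λ (a₃ , _) → contradiction (trans (sym a₁) a₃) λ ())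
      separated : ∀ {x y} → Far G conn x y → SeparatedThreeWalk f x y
      separated {x} {y} far with w , z , x~w , w~z , z~y ← far-walk G conn far
        with (dist w u ℕ.≟ 3) ×-dec (dist z u ℕ.≟ 3)
      ... | no ¬L₃ = w , z , x~w , w~z , z~y , separates (w~z , ¬L₃)
      -- The ends lie at distance 2 or 3 from `u`. Both at 3 would be adjacent by the clique
      -- condition, and both at 2 would have the common neighbour `a`; in a mixed pair the walk goes
      -- through `a`.
      ... | yes (w₃ , z₃) with beside-L₃ x~w w₃ | beside-L₃ (~-sym z~y) z₃
      ...   | inj₁ x₂ | inj₂ y₃ = via-a x₂ y₃
      ...   | inj₂ x₃ | inj₁ y₂ = SeparatedThreeWalk-sym f (via-a y₂ x₃)
      ...   | inj₂ x₃ | inj₂ y₃ = contradiction (clique c~c′ x₃ y₃ (Far⇒≢ G conn far)) (Far⇒≁ G conn far)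
      ...   | inj₁ x₂ | inj₁ y₂ = contradiction
        (≤-trans (≤-reflexive (sym far)) (dist≤len (~a x₂ ◅ ~-sym (~a y₂) ◅ ε))) λ { (s≤s (s≤s ())) }

    result : ProperColours G (2 + k)
    result with c ~? c′
    -- With `a′` taken to be `a`, the class is `a`, `c`, `c′`.
    ... | no c≁c′ = fromProper (ladder _~_ ~-sym id a₁ (λ _ → c≁c′))
    ... | yes c~c′ with any? (λ a′ → (dist a′ u ℕ.≟ 1) ×-dec ¬? (a′ ≟ a))
    -- A second neighbour of `u` lets the adjacent `c` and `c′` go into different classes.
    ...   | yes (a′ , a′₁ , a′≢a) = fromProper (ladder _~_ ~-sym id a′₁ (λ a≡a′ → contradiction (sym a≡a′) a′≢a))
    ...   | no only-a = pendant c~c′ λ {x} x₁ → decidable-stable (x ≟ a) λ x≢a → only-a (x , x₁ , x≢a)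

  private
    far? : ∀ x y → Dec (Far G conn x y)
    far? x y = dist x y ℕ.≟ 3

  matching⇒n-3 : (∀ x y → dist x y ≤ 3) → FarMatching G conn → ∀ {u v} → Far G conn u v →
                 SufficientColours G (2 + k)
  matching⇒n-3 ≤3 match {u} {v} uv
    with (any? λ x → any? λ y → far? x y ×-dec ¬? (_∈?_ _≟_ x (u ∷ v ∷ [])))
  -- The only pair is passed twice; two colours are at most n - 3 since n ≥ 5.
  ... | no none = sufficientColours-mono G (s≤s (s≤s z≤n)) (one-or-two-pairs G conn match ≤3 uv uv λ {s} {t} st →
          decidable-stable (_∈?_ _≟_ s _) λ s∉ →
          none (s , t , st , λ { (here e) → s∉ (here e) ; (there (here e)) → s∉ (there (here e)) }))
  ... | yes (x , y , xy , x∉)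
      with (any? λ s → any? λ t → far? s t ×-dec ¬? (_∈?_ _≟_ s (u ∷ v ∷ x ∷ y ∷ [])))
  ...   | yes (s , t , st , s∉) = three-pairs G conn match refl uv xy st x∉ s∉
  ...   | no none = sufficientColours-mono G (s≤s (s≤s z≤n)) (one-or-two-pairs G conn match ≤3 uv xy λ {s} {t} st →
          decidable-stable (_∈?_ _≟_ s _) λ s∉ → none (s , t , st , s∉))

  diameter≥3⇒n-3 : ∀ {u v} → 3 ≤ dist u v → SufficientColours G (2 + k)
  diameter≥3⇒n-3 {u} {v} ≥3 with (any? λ x → any? λ y → 4 ≤? dist x y)
  ... | yes (_ , _ , ≥4) = diameter≥4⇒n-3 ≥4
  ... | no ≱4
      -- Nonadjacent pairs are sought first, so that failure supplies the clique condition for the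
      -- next search.
      with (any? λ w → any? λ c → any? λ c′ → far? c w ×-dec far? c′ w ×-dec ¬? (c ≟ c′) ×-dec ¬? (c ~? c′))
  ...   | yes (w , c , c′ , c₃ , c′₃ , c≢c′ , c≁c′) =
          two-far⇒n-3 (none>⇒dist≤ ≱4) c₃ c′₃ c≢c′ (λ c~c′ → contradiction c~c′ c≁c′)
  ...   | no cliques
        with (any? λ w → any? λ c → any? λ c′ → far? c w ×-dec far? c′ w ×-dec ¬? (c ≟ c′))
  ...     | yes (w , c , c′ , c₃ , c′₃ , c≢c′) =
            two-far⇒n-3 (none>⇒dist≤ ≱4) c₃ c′₃ c≢c′ λ _ {x} {y} x₃ y₃ x≢y →
              decidable-stable (x ~? y) λ x≁y → cliques (w , x , y , x₃ , y₃ , x≢y , x≁y)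
  ...     | no matched = matching⇒n-3 (none>⇒dist≤ ≱4)
            (λ {w} {c} {c′} c₃ c′₃ → decidable-stable (c ≟ c′) λ c≢c′ → matched (w , c , c′ , c₃ , c′₃ , c≢c′))
            (≤-antisym (none>⇒dist≤ ≱4 u v) ≥3)

-- The upper bound and the graphs that can attain it.

Bounded : ∀ {n} → Graph n → Set
Bounded {n} G = ∃ λ m → SufficientColours G m × m ≤ n ∸ 2 ×
                        -- The single edge has n - 2 = 0 = `m` and is neither P₃ nor P₄, hence the
                        -- guard.
                        (3 ≤ n → m ≡ n ∸ 2 → G ≅ P 3 ⊎ G ≅ P 4)

diameter≥3⇒bounded : ∀ {n} (G : Graph n) (conn : Connected G) {u v : Fin n} →
                     3 ≤ Distance.dist G conn u v → Bounded G
diameter≥3⇒bounded {0} G conn {()}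
diameter≥3⇒bounded {1} G conn {u} {v} ≥3 with s≤s () ← ≤-trans (s≤s ≥3) (Distance.dist<n G conn u v)
diameter≥3⇒bounded {2} G conn {u} {v} ≥3 with s≤s (s≤s ()) ← ≤-trans (s≤s ≥3) (Distance.dist<n G conn u v)
diameter≥3⇒bounded {3} G conn {u} {v} ≥3 with s≤s (s≤s (s≤s ())) ← ≤-trans (s≤s ≥3) (Distance.dist<n G conn u v)
diameter≥3⇒bounded {4} G conn {u} {v} ≥3 = 2 , path⇒2-colours G conn G≅P₄ , ≤-refl , λ _ _ → inj₂ G≅P₄
  where
  G≅P₄ : G ≅ P 4
  G≅P₄ = diametral⇒path G conn (≤-antisym (s≤s⁻¹ (Distance.dist<n G conn u v)) ≥3)
diameter≥3⇒bounded {suc (suc (suc (suc (suc k))))} G conn ≥3 =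
  -- This is n - 3, so equality with n - 2 is impossible.
  2 + k , diameter≥3⇒n-3 G conn ≥3 , ℕ.n≤1+n _ , λ _ eq → contradiction (sym eq) ℕ.1+n≢n

diameter≡2⇒bounded : ∀ {n} (G : Graph n) (conn : Connected G) →
                     (∀ x y → Distance.dist G conn x y ≤ 2) →
                     ∀ {u v : Fin n} → 2 ≤ Distance.dist G conn u v → Bounded G
diameter≡2⇒bounded {0} G conn _ {()}
diameter≡2⇒bounded {1} G conn _ {u} {v} ≥2 with s≤s () ← ≤-trans (s≤s ≥2) (Distance.dist<n G conn u v)
diameter≡2⇒bounded {2} G conn _ {u} {v} ≥2 with s≤s (s≤s ()) ← ≤-trans (s≤s ≥2) (Distance.dist<n G conn u v)
diameter≡2⇒bounded {suc (suc (suc k))} G conn ≤2 {u} {v} ≥2 =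
  1 , (const zero , Distance.diameter≤3 G conn (const zero) (λ x y → inj₁ (≤2 x y))) , s≤s z≤n , path k G conn ≤2 ≥2
  where
  path : ∀ k (G : Graph (3 + k)) (conn : Connected G) → (∀ x y → Distance.dist G conn x y ≤ 2) →
         ∀ {u v} → 2 ≤ Distance.dist G conn u v → 3 ≤ 3 + k → 1 ≡ 1 + k → G ≅ P 3 ⊎ G ≅ P 4
  -- A positive `k` contradicts `1 ≡ 1 + k`; on three vertices a distance of 2 is diametral.
  path zero G conn ≤2 ≥2 _ _ = inj₁ (diametral⇒path G conn (≤-antisym (≤2 _ _) ≥2))

module _ {n : ℕ} (G : Graph n) (conn : Connected G) where
  open Distance G conn

  bounded : Bounded G
  bounded with (any? λ u → any? λ v → 3 ≤? dist u v)
  ... | yes (_ , _ , ≥3) = diameter≥3⇒bounded G conn ≥3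
  ... | no ≱3 with (any? λ u → any? λ v → 2 ≤? dist u v)
  ...   | yes (_ , _ , ≥2) = diameter≡2⇒bounded G conn (none>⇒dist≤ ≱3) ≥2
  ...   | no ≱2 = 0 , complete , z≤n , λ 3≤n eq → contradiction (ℕ.m<n⇒0<n∸m 3≤n) (ℕ.≤⇒≯ (≤-reflexive (sym eq)))
    where
    complete : Complete G
    complete u v u≢v = dist≡1⇒~ (≤-antisym (none>⇒dist≤ ≱2 u v) (ℕ.n≢0⇒n>0 (u≢v ∘ dist≡0⇒≡)))

-- P₃ and P₄ attain the bound.

P₃⇒attained : ∀ {n k} (G : Graph n) → IsSpvc G k → k ≤ n ∸ 2 → G ≅ P 3 → k ≡ n ∸ 2
P₃⇒attained G (suff , _) k≤ iso with refl ← ↔⇒≡ (_≅_.bijection iso) = exact suff k≤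
  where
  exact : ∀ {k} → SufficientColours G k → k ≤ 1 → k ≡ 1
  -- Complete graphs have walks of length at most 1 between any two vertices, but the ends of P₃
  -- need 2.
  exact {0}           suff _        with s≤s () ← path-width G iso (0-colours⇒within-1 G suff)
  exact {1}           _    _        = refl
  exact {suc (suc _)} _    (s≤s ())

P₄⇒attained : ∀ {n k} (G : Graph n) → IsSpvc G k → k ≤ n ∸ 2 → G ≅ P 4 → k ≡ n ∸ 2
P₄⇒attained G (suff , _) k≤ iso with refl ← ↔⇒≡ (_≅_.bijection iso) = exact suff k≤
  where
  exact : ∀ {k} → SufficientColours G k → k ≤ 2 → k ≡ 2
  exact {0} suff _ with s≤s () ← path-width G iso (0-colours⇒within-1 G suff)
  -- One colour allows walks of length at most 2, but the ends of P₄ need 3.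
  exact {1} suff _ with s≤s (s≤s ()) ← path-width G iso (1-colour⇒within-2 G suff)
  exact {2} _ _ = refl
  exact {suc (suc (suc _))} _ (s≤s (s≤s ()))

theorem6 : ∀ (n : ℕ) (G : Graph n) → 2 ≤ n → Connected G →
    ∃[ k ] (IsSpvc G k
    × (0 ≤ k × k ≤ n ∸ 2)
    × (3 ≤ n → (k ≡ n ∸ 2 ⇔ (G ≅ P 3 ⊎ G ≅ P 4))))
theorem6 n G _ conn
  with m , suff , m≤n-2 , attained ← bounded G conn
  -- The bound `m` starts a decidable search for the minimum, which is spvc.
  with k , spvc ← least (Distance.sufficientColours? G conn) suff =
  k , spvc , (z≤n , k≤n-2) , λ 3≤n → mk⇔
    -- From `k ≤ m ≤ n ∸ 2`, equality for `k` forces equality for `m`.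
    (λ k≡n-2 → attained 3≤n (≤-antisym m≤n-2 (≤-trans (≤-reflexive (sym k≡n-2)) k≤m)))
    [ P₃⇒attained G spvc k≤n-2 , P₄⇒attained G spvc k≤n-2 ]′
  where
  k≤m : k ≤ m
  k≤m = proj₂ spvc m suff
  k≤n-2 : k ≤ n ∸ 2
  k≤n-2 = ≤-trans k≤m m≤n-2
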